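{- Let $G$ and $H$ be connected cubic graphs and let $l \geq 1$ be an integer. Then $\chi_=(G \circ^l H) = 3$ if and only if $G$ has a strong equitable $3$-coloring and $H$ is $2$-chromatic (i.e. $H \in Q_2$).
   Context: All graphs are finite and simple. A cubic graph is a $3$-regular graph; $Q_2$ denotes the class of connected cubic graphs with chromatic number $2$. A graph $F$ is equitably $k$-colorable if $V(F)$ can be partitioned into $k$ (possibly empty) independent sets $V_1,\dots,V_k$ with $\bigl||V_i|-|V_j|\bigr|\le 1$ for all $i,j$. The equitable chromatic number $\chi_=(F)$ is the smallest integer $k$ such that $F$ is equitably $k$-colorable. A strong equitable $k$-coloring of $F$ is a partition of $V(F)$ into $k$ independent sets all of the same cardinality. The corona $G\circ H$ of graphs $G$ and $H$ is formed from one copy of $G$ and $|V(G)|$ disjoint copies of $H$ by joining the $i$-th vertex of $G$ to every vertex of the $i$-th copy of $H$. The $l$-corona product is defined by $G\circ^1 H = G\circ H$ and $G\circ^l H = (G\circ^{l-1}H)\circ H$ for $l\ge 2$. -}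

module Defs where

open import Data.Fin.Base using (Fin)
open import Data.Fin.Properties using (+↔⊎; *↔×; inj⇒≟; _≟_)
open import Data.List.Base using (List; length; filter; tabulate)
open import Data.Nat.Base using (ℕ; zero; suc; _+_; _*_; _≤_; ∣_-_∣)
open import Data.Product.Base using (_×_; _,_; Σ-syntax)
open import Data.Product.Function.NonDependent.Propositional using (_×-↔_)
open import Data.Sum.Base using (_⊎_; inj₁; inj₂)
open import Data.Sum.Function.Propositional using (_⊎-↔_)
open import Function.Bundles using (_↔_; module Inverse)
open import Function.Construct.Composition using (_↔-∘_)
open import Function.Construct.Symmetry using (↔-sym)
open import Function.Properties.Inverse using (↔⇒↣)
open import Level using (0ℓ)
open import Relation.Binary.Construct.Closure.ReflexiveTransitive using (Star)
open import Relation.Binary.Core using (Rel)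
open import Relation.Binary.Definitions
  using (Symmetric; Irreflexive; Decidable; DecidableEquality)
open import Relation.Binary.PropositionalEquality
  using (_≡_; _≢_; refl; sym)
open import Relation.Nullary.Decidable using (_×-dec_)
open import Relation.Unary using (Pred) renaming (Decidable to Decidable₁)

record Graph : Set₁ where
  infix 4 _~_ _~?_
  field
    V        : Set
    order    : ℕ
    finite   : V ↔ Fin order
    _~_      : Rel V 0ℓ
    _~?_     : Decidable _~_
    ~-sym    : Symmetric _~_
    ~-irrefl : Irreflexive _≡_ _~_

  -- Every vertex occurs exactly once, because finite is a bijection.
  vertices : List V
  vertices = tabulate (Inverse.from finite)

  _≟ⱽ_ : DecidableEquality V
  _≟ⱽ_ = inj⇒≟ (↔⇒↣ finite)

  card : {P : Pred V 0ℓ} → Decidable₁ P → ℕ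
  card P? = length (filter P? vertices)

  degree : V → ℕ
  degree v = card (v ~?_)

-- The graph on the empty vertex set does not count as connected.
Connected : Graph → Set
Connected G = V × (∀ u v → Star _~_ u v)
  where open Graph G

Cubic : Graph → Set
Cubic G = ∀ v → degree v ≡ 3
  where open Graph G

-- A partition of the vertices into k possibly empty independent sets,
-- given by the map sending each vertex to the index of its part.
record Colouring (G : Graph) (k : ℕ) : Set where
  open Graph G
  field
    colour : V → Fin k
    proper : ∀ {u v} → u ~ v → colour u ≢ colour v

  classSize : Fin k → ℕ
  classSize i = card (λ v → colour v ≟ i)

open Colouring using (classSize)

Colourable : Graph → ℕ → Set
Colourable = Colouring

EquitablyColourable : Graph → ℕ → Set
EquitablyColourable G k =
  Σ[ c ∈ Colouring G k ] (∀ i j → ∣ classSize c i - classSize c j ∣ ≤ 1)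

StronglyEquitablyColourable : Graph → ℕ → Set
StronglyEquitablyColourable G k =
  Σ[ c ∈ Colouring G k ] (∀ i j → classSize c i ≡ classSize c j)

IsLeast : Pred ℕ 0ℓ → ℕ → Set
IsLeast P k = P k × (∀ j → P j → k ≤ j)

infix 4 χ_≡_ χ₌_≡_

χ_≡_ : Graph → ℕ → Set
χ G ≡ k = IsLeast (Colourable G) k

χ₌_≡_ : Graph → ℕ → Set
χ₌ G ≡ k = IsLeast (EquitablyColourable G) k

Q₂ : Graph → Set
Q₂ G = Connected G × Cubic G × χ G ≡ 2

module _ (G H : Graph) where
  private
    module G = Graph G
    module H = Graph H

  -- inj₁ u is the vertex u of G; inj₂ (u , x) is the vertex x of the
  -- copy of H attached to u.
  CoronaVertex : Set
  CoronaVertex = G.V ⊎ (G.V × H.V)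

  CoronaAdj : Rel CoronaVertex 0ℓ
  CoronaAdj (inj₁ u)       (inj₁ v)       = u G.~ v
  CoronaAdj (inj₁ u)       (inj₂ (v , y)) = u ≡ v
  CoronaAdj (inj₂ (u , x)) (inj₁ v)       = u ≡ v
  CoronaAdj (inj₂ (u , x)) (inj₂ (v , y)) = u ≡ v × x H.~ y

  private
    adj? : Decidable CoronaAdj
    adj? (inj₁ u)       (inj₁ v)       = u G.~? v
    adj? (inj₁ u)       (inj₂ (v , y)) = u G.≟ⱽ v
    adj? (inj₂ (u , x)) (inj₁ v)       = u G.≟ⱽ v
    adj? (inj₂ (u , x)) (inj₂ (v , y)) = (u G.≟ⱽ v) ×-dec (x H.~? y)

    adj-sym : Symmetric CoronaAdj
    adj-sym {inj₁ _} {inj₁ _} p       = G.~-sym p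
    adj-sym {inj₁ _} {inj₂ _} p       = sym p
    adj-sym {inj₂ _} {inj₁ _} p       = sym p
    adj-sym {inj₂ _} {inj₂ _} (p , q) = sym p , H.~-sym q

    adj-irrefl : Irreflexive _≡_ CoronaAdj
    adj-irrefl {inj₁ _} refl p       = G.~-irrefl refl p
    adj-irrefl {inj₂ _} refl (_ , q) = H.~-irrefl refl q

  corona : Graph
  corona = record
    { V        = CoronaVertex
    ; order    = G.order + G.order * H.order
    ; finite   = ↔-sym +↔⊎ ↔-∘ (G.finite ⊎-↔ (↔-sym *↔× ↔-∘ (G.finite ×-↔ H.finite)))
    ; _~_      = CoronaAdj
    ; _~?_     = adj?
    ; ~-sym    = λ {u} {v} → adj-sym {u} {v}
    ; ~-irrefl = λ {u} {v} → adj-irrefl {u} {v}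
    }

-- The l-corona product G ∘^l H for l ≥ 1; the value at l = 0 is a convention
-- under which l = 1 gives the corona itself.
coronaPower : Graph → ℕ → Graph → Graph
coronaPower G zero    H = G
coronaPower G (suc l) H = corona (coronaPower G l H) H

{-# OPTIONS --safe #-}
-- A 2-colouring of a cubic graph is balanced, by counting the edges between
-- its classes from either side.  In a 3-coloured corona G ∘ H each copy of H
-- avoids the colour of its root, so it is 2-coloured and splits evenly between
-- the other two colours.  Writing n and m for the orders of G and H, and sⱼ and
-- tⱼ for the number of vertices of colour j in G and in G ∘ H, this gives
-- 2 tⱼ + m sⱼ = n m + 2 sⱼ.  Hence the tⱼ are equal when the sⱼ are.
-- Conversely m ≥ 6, since a class contains the three neighbours of a vertex in
-- the other class, so sᵢ ≠ sⱼ forces ∣ tᵢ - tⱼ ∣ ≥ 2.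
module Submission where

open import Defs
open import Data.Bool.Base using (true; false; if_then_else_)
open import Data.Fin.Base using (Fin; zero; suc; punchIn; punchOut; splitAt; remQuot)
open import Data.Fin.Properties
  using (_≟_; punchInᵢ≢i; punchIn-injective; punchOut-cong; punchOut-injective)
open import Data.List.Base using (_∷_; length; filter; tabulate)
open import Data.Nat.Base
  using (ℕ; zero; suc; _+_; _*_; _≤_; _<_; z≤n; s≤s; ∣_-_∣)
open import Data.Nat.Properties
  using ( +-*-semiring; +-comm; +-assoc; +-suc; +-identityʳ; +-cancelʳ-≡; +-cancelˡ-≤; +-monoʳ-≤
        ; *-comm; *-identityʳ; *-zeroʳ; *-cancelˡ-≡; *-cancelˡ-≤; *-monoʳ-≤
        ; ≤-refl; ≤-trans; ≤-reflexive; <-cmp; <-irrefl; m≤m+n; +-mono-≤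
        ; m≤n+∣m-n∣; m≡n⇒∣m-n∣≡0; m≤n⇒∃[o]m+o≡n; module ≤-Reasoning)
open import Data.Nat.Tactic.RingSolver using (solve-∀)
open import Data.Product.Base using (_×_; _,_; proj₁; proj₂; ∃)
open import Data.Sum.Base using (_⊎_; inj₁; inj₂; [_,_]′)
open import Function.Base using (_∘_)
open import Function.Bundles using (_⇔_; mk⇔; module Inverse)
open import Relation.Binary.Definitions using (tri<; tri≈; tri>)
open import Relation.Binary.PropositionalEquality
  using (_≡_; _≢_; refl; sym; trans; cong; cong₂; module ≡-Reasoning)
open import Relation.Nullary.Decidable using (Dec; does; yes; no)
open import Relation.Nullary.Negation using (¬_; contradiction)
open import Relation.Unary using (Pred) renaming (Decidable to Decidable₁)
open import Level using (0ℓ)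

open import Algebra.Properties.Semiring.Sum +-*-semiring
  using (sum; sum-cong-≗; ∑-distrib-+; ∑-comm; *-distribˡ-sum)

open Graph using (V; order)
open Colouring using (colour; proper; classSize)

private variable
  A P : Set

-- Indicators and finite sums.

𝟙 : Dec P → ℕ
𝟙 d = if does d then 1 else 0

-- With counts written as sums of indicators, double counting becomes an exchange of summations.
length-filter-tabulate : {Q : Pred A 0ℓ} (Q? : Decidable₁ Q) {n : ℕ} (f : Fin n → A) →
  length (filter Q? (tabulate f)) ≡ sum (λ i → 𝟙 (Q? (f i)))
length-filter-tabulate Q? {zero}  f = refl
length-filter-tabulate Q? {suc n} f with does (Q? (f zero))
... | true  = cong suc (length-filter-tabulate Q? (f ∘ suc))
... | false = length-filter-tabulate Q? (f ∘ suc)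

-- A vertex index of a corona is decoded by `splitAt` and then `remQuot`. This lemma and
-- `sum-remQuot` follow those two stages when a sum over a corona is broken up.
sum-splitAt : ∀ m {n} (f : Fin m ⊎ Fin n → ℕ) →
  sum (f ∘ splitAt m) ≡ sum (f ∘ inj₁) + sum (f ∘ inj₂)
sum-splitAt zero    f = refl
sum-splitAt (suc m) f = trans
  (cong (f (inj₁ zero) +_) (trans (sum-cong-≗ splitAt-suc) (sum-splitAt m f′)))
  (sym (+-assoc (f (inj₁ zero)) _ _))
  where
  f′ = [ f ∘ inj₁ ∘ suc , f ∘ inj₂ ]′
  splitAt-suc : ∀ i → f (splitAt (suc m) (suc i)) ≡ f′ (splitAt m i)
  splitAt-suc i with splitAt m i
  ... | inj₁ _ = refl
  ... | inj₂ _ = refl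

sum-remQuot : ∀ m {n} (f : Fin m × Fin n → ℕ) →
  sum (f ∘ remQuot {m} n) ≡ sum (λ i → sum (λ j → f (i , j)))
sum-remQuot zero        f = refl
sum-remQuot (suc m) {n} f = begin
  sum (f ∘ remQuot {suc m} n)
    ≡⟨ sum-cong-≗ remQuot-suc ⟩
  sum (f′ ∘ splitAt n)
    ≡⟨ sum-splitAt n f′ ⟩
  sum (λ j → f (zero , j)) + sum (f″ ∘ remQuot {m} n)
    ≡⟨ cong (sum (λ j → f (zero , j)) +_) (sum-remQuot m f″) ⟩
  sum (λ i → sum (λ j → f (i , j))) ∎
  where
  open ≡-Reasoning
  f″ : Fin m × Fin n → ℕ
  f″ (i , j) = f (suc i , j)
  f′ : Fin n ⊎ Fin (m * n) → ℕ
  f′ = [ (λ j → f (zero , j)) , f″ ∘ remQuot {m} n ]′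
  remQuot-suc : ∀ k → f (remQuot {suc m} n k) ≡ f′ (splitAt n k)
  remQuot-suc k with splitAt n k
  ... | inj₁ _ = refl
  ... | inj₂ _ = refl

sum-const : ∀ n k → sum {n} (λ _ → k) ≡ n * k
sum-const zero    k = refl
sum-const (suc n) k = cong (k +_) (sum-const n k)

sum-mono-≤ : ∀ {n} {f g : Fin n → ℕ} → (∀ i → f i ≤ g i) → sum f ≤ sum g
sum-mono-≤ {zero}  f≤g = z≤n
sum-mono-≤ {suc n} f≤g = +-mono-≤ (f≤g zero) (sum-mono-≤ (f≤g ∘ suc))

-- Sums over the vertices of a graph.

vertexAt : (G : Graph) → Fin (order G) → V G
vertexAt G = Inverse.from (Graph.finite G)

-- Opaque so that unification can read the summand off a sum.
opaque
  ∑ : (G : Graph) → (V G → ℕ) → ℕ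
  ∑ G f = sum (f ∘ vertexAt G)

module _ (G : Graph) where
  open Graph G using (_~_; _~?_; ~-sym; degree; card)

  opaque
    unfolding ∑

    card≡∑ : {Q : Pred (V G) 0ℓ} (Q? : Decidable₁ Q) → card Q? ≡ ∑ G (λ v → 𝟙 (Q? v))
    card≡∑ Q? = length-filter-tabulate Q? (vertexAt G)

    ∑-cong : {f g : V G → ℕ} → (∀ v → f v ≡ g v) → ∑ G f ≡ ∑ G g
    ∑-cong {f} {g} f≗g = sum-cong-≗ {x = f ∘ vertexAt G} {y = g ∘ vertexAt G} (f≗g ∘ vertexAt G)

    ∑-+ : (f g : V G → ℕ) → ∑ G (λ v → f v + g v) ≡ ∑ G f + ∑ G g
    ∑-+ f g = ∑-distrib-+ (f ∘ vertexAt G) (g ∘ vertexAt G)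

    *-∑ : ∀ k (f : V G → ℕ) → k * ∑ G f ≡ ∑ G (λ v → k * f v)
    *-∑ k f = *-distribˡ-sum k (f ∘ vertexAt G)

    ∑-swap : (f : V G → V G → ℕ) →
      ∑ G (λ v → ∑ G (λ w → f v w)) ≡ ∑ G (λ w → ∑ G (λ v → f v w))
    ∑-swap f = ∑-comm (λ i j → f (vertexAt G i) (vertexAt G j))

    ∑-const : ∀ k → ∑ G (λ _ → k) ≡ order G * k
    ∑-const = sum-const (order G)

    ∑-mono-≤ : {f g : V G → ℕ} → (∀ v → f v ≤ g v) → ∑ G f ≤ ∑ G g
    ∑-mono-≤ {f} {g} f≤g = sum-mono-≤ {f = f ∘ vertexAt G} {g ∘ vertexAt G} (f≤g ∘ vertexAt G)

  ~?-swap : ∀ v w → 𝟙 (v ~? w) ≡ 𝟙 (w ~? v)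
  ~?-swap v w with v ~? w | w ~? v
  ... | yes _   | yes _   = refl
  ... | no _    | no _    = refl
  ... | yes v~w | no w≁v  = contradiction (~-sym v~w) w≁v
  ... | no v≁w  | yes w~v = contradiction (~-sym w~v) v≁w

  degree-positive⇒neighbour : ∀ {k} v → degree v ≡ suc k → ∃ λ w → v ~ w
  degree-positive⇒neighbour v deg = search (Graph.vertices G) deg
    where
    search : ∀ {k} ws → length (filter (v ~?_) ws) ≡ suc k → ∃ λ w → v ~ w
    search (w ∷ ws) eq with v ~? w
    ... | yes v~w = w , v~w
    ... | no _    = search ws eq

  edge⇒2≤k : ∀ {k v w} → v ~ w → Colourable G k → 2 ≤ k
  edge⇒2≤k {zero} {v} v~w c with () ← colour c v
  edge⇒2≤k {suc zero} {v} {w} v~w c with colour c v | colour c w | proper c v~w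
  ... | zero | zero | 0≢0 = contradiction refl 0≢0
  edge⇒2≤k {suc (suc k)} v~w c = s≤s (s≤s z≤n)

  classSize≡∑ : ∀ {k} (c : Colouring G k) i → classSize c i ≡ ∑ G (λ v → 𝟙 (colour c v ≟ i))
  classSize≡∑ c i = card≡∑ (λ v → colour c v ≟ i)

-- Two-coloured cubic graphs.

Fin2-swap : {i j k l : Fin 2} → i ≢ j → k ≢ l → i ≡ k → j ≡ l
Fin2-swap {_}        {zero}     {_}        {zero}     _   _   _    = refl
Fin2-swap {_}        {suc zero} {_}        {suc zero} _   _   _    = refl
Fin2-swap {zero}     {zero}     i≢j _   _    = contradiction refl i≢j
Fin2-swap {suc zero} {suc zero} i≢j _   _    = contradiction refl i≢j
Fin2-swap {zero}     {suc zero} {_} {zero} _ k≢l refl = contradiction refl k≢l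
Fin2-swap {suc zero} {zero} {_} {suc zero} _ k≢l refl = contradiction refl k≢l

module _ (H : Graph) (cubic : Cubic H) (d : Colouring H 2) where
  open Graph H using (_~_; _~?_; degree)

  private
    #_ : Fin 2 → ℕ
    # i = ∑ H (λ x → 𝟙 (colour d x ≟ i))

    -- Both count ordered pairs of adjacent vertices, selected by the colour of the first vertex or
    -- of the second.
    edges-from edges-to : Fin 2 → ℕ
    edges-from i = ∑ H λ x → ∑ H λ y → 𝟙 (colour d x ≟ i) * 𝟙 (x ~? y)
    edges-to i   = ∑ H λ x → ∑ H λ y → 𝟙 (colour d y ≟ i) * 𝟙 (x ~? y)

    edges-from≡ : ∀ i → edges-from i ≡ 3 * # i
    edges-from≡ i = trans (∑-cong H at) (sym (*-∑ H 3 _))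
      where
      at : ∀ x → ∑ H (λ y → 𝟙 (colour d x ≟ i) * 𝟙 (x ~? y)) ≡ 3 * 𝟙 (colour d x ≟ i)
      at x = trans (sym (*-∑ H e _)) (trans
        (cong (e *_) (trans (sym (card≡∑ H (x ~?_))) (cubic x))) (*-comm e 3))
        where e = 𝟙 (colour d x ≟ i)

    edges-to≡from : ∀ i → edges-to i ≡ edges-from i
    edges-to≡from i = trans (∑-swap H _)
      (∑-cong H λ y → ∑-cong H λ x → cong (𝟙 (colour d y ≟ i) *_) (~?-swap H x y))

    -- An edge leaving class `i` must end in the only other class, so the two sums agree term by
    -- term.
    edges-from≡to : ∀ {i j} → i ≢ j → edges-from i ≡ edges-to j
    edges-from≡to {i} {j} i≢j = ∑-cong H λ x → ∑-cong H λ y → at x y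
      where
      at : ∀ x y → 𝟙 (colour d x ≟ i) * 𝟙 (x ~? y) ≡ 𝟙 (colour d y ≟ j) * 𝟙 (x ~? y)
      at x y with x ~? y
      ... | no _ = trans (*-zeroʳ (𝟙 (colour d x ≟ i))) (sym (*-zeroʳ (𝟙 (colour d y ≟ j))))
      ... | yes x~y with colour d x ≟ i | colour d y ≟ j
      ...   | yes _   | yes _   = refl
      ...   | no _    | no _    = refl
      ...   | yes x≡i | no y≢j  = contradiction (Fin2-swap (proper d x~y) i≢j x≡i) y≢j
      ...   | no x≢i  | yes y≡j =
        contradiction (Fin2-swap (proper d x~y ∘ sym) (i≢j ∘ sym) y≡j) x≢i

    balanced : # zero ≡ # suc zero
    balanced = *-cancelˡ-≡ _ _ 3 (begin
      3 * # zero           ≡⟨ edges-from≡ zero ⟨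
      edges-from zero      ≡⟨ edges-from≡to (λ ()) ⟩
      edges-to (suc zero)  ≡⟨ edges-to≡from (suc zero) ⟩
      edges-from (suc zero) ≡⟨ edges-from≡ (suc zero) ⟩
      3 * # suc zero       ∎)
      where open ≡-Reasoning

    total : # zero + # suc zero ≡ order H
    total = begin
      # zero + # suc zero  ≡⟨ ∑-+ H _ _ ⟨
      ∑ H (λ x → 𝟙 (colour d x ≟ zero) + 𝟙 (colour d x ≟ suc zero))
                           ≡⟨ ∑-cong H (λ x → one (colour d x)) ⟩
      ∑ H (λ _ → 1)        ≡⟨ ∑-const H 1 ⟩
      order H * 1          ≡⟨ *-identityʳ (order H) ⟩
      order H              ∎
      where
      open ≡-Reasoning
      one : (a : Fin 2) → 𝟙 (a ≟ zero) + 𝟙 (a ≟ suc zero) ≡ 1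
      one zero       = refl
      one (suc zero) = refl

  -- The two classes are equal and add up to the order. The factor 2 avoids division in ℕ.
  2-class-half : ∀ a → 2 * ∑ H (λ x → 𝟙 (colour d x ≟ a)) ≡ order H
  2-class-half zero       = trans (cong (# zero +_) (trans (+-identityʳ _) balanced)) total
  2-class-half (suc zero) =
    trans (cong₂ _+_ (sym balanced) (+-identityʳ (# suc zero))) total

  -- The three neighbours of x all lie outside its class, which is half of H.
  6≤order : V H → 6 ≤ order H
  -- The extra `order H` on the left is there to be traded for `2 * # a`.
  6≤order x = +-cancelˡ-≤ (order H) 6 (order H) (begin
    order H + 6                  ≡⟨ cong (_+ 6) (2-class-half a) ⟨
    2 * # a + 6                  ≡⟨ arith (# a) ⟩
    2 * (3 + # a)                ≤⟨ *-monoʳ-≤ 2 3+#a≤order ⟩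
    2 * order H                  ≡⟨ cong (order H +_) (+-identityʳ _) ⟩
    order H + order H            ∎)
    where
    open ≤-Reasoning
    a = colour d x
    arith : ∀ s → 2 * s + 6 ≡ 2 * (3 + s)
    arith = solve-∀
    at-most-one : ∀ y → 𝟙 (x ~? y) + 𝟙 (colour d y ≟ a) ≤ 1
    at-most-one y with x ~? y | colour d y ≟ a
    ... | yes x~y | yes y≡a = contradiction (sym y≡a) (proper d x~y)
    ... | yes _   | no _    = ≤-refl
    ... | no _    | yes _   = ≤-refl
    ... | no _    | no _    = z≤n
    3+#a≤order : 3 + # a ≤ order H
    3+#a≤order = begin
      3 + # a         ≡⟨ cong (_+ # a) (trans (sym (cubic x)) (card≡∑ H (x ~?_))) ⟩
      ∑ H (λ y → 𝟙 (x ~? y)) + # a ≡⟨ ∑-+ H _ _ ⟨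
      ∑ H (λ y → 𝟙 (x ~? y) + 𝟙 (colour d y ≟ a)) ≤⟨ ∑-mono-≤ H at-most-one ⟩
      ∑ H (λ _ → 1)   ≡⟨ ∑-const H 1 ⟩
      order H * 1     ≡⟨ *-identityʳ (order H) ⟩
      order H         ∎

-- Colourings and class sizes of a corona.

module _ (G H : Graph) where

  opaque
    unfolding ∑

    -- Grouping each root with its own copy of `H` allows class sizes to be compared root by root.
    ∑-corona : (f : V (corona G H) → ℕ) →
      ∑ (corona G H) f ≡ ∑ G (λ u → f (inj₁ u) + ∑ H (λ x → f (inj₂ (u , x))))
    ∑-corona f = begin
      ∑ (corona G H) f
        ≡⟨ sum-cong-≗ pull ⟩
      sum (g ∘ splitAt (order G))
        ≡⟨ sum-splitAt (order G) g ⟩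
      ∑ G (f ∘ inj₁) + sum (h ∘ remQuot {order G} (order H))
        ≡⟨ cong (∑ G (f ∘ inj₁) +_) (sum-remQuot (order G) h) ⟩
      ∑ G (f ∘ inj₁) + ∑ G (λ u → ∑ H (λ x → f (inj₂ (u , x))))
        ≡⟨ ∑-+ G (f ∘ inj₁) (λ u → ∑ H (λ x → f (inj₂ (u , x)))) ⟨
      ∑ G (λ u → f (inj₁ u) + ∑ H (λ x → f (inj₂ (u , x)))) ∎
      where
      open ≡-Reasoning
      h : Fin (order G) × Fin (order H) → ℕ
      h (i , j) = f (inj₂ (vertexAt G i , vertexAt H j))
      g : Fin (order G) ⊎ Fin (order G * order H) → ℕ
      g = [ f ∘ inj₁ ∘ vertexAt G , h ∘ remQuot {order G} (order H) ]′
      pull : ∀ i → f (vertexAt (corona G H) i) ≡ g (splitAt (order G) i)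
      pull i with splitAt (order G) i
      ... | inj₁ _ = refl
      ... | inj₂ _ = refl

  baseColouring : ∀ {k} → Colouring (corona G H) k → Colouring G k
  baseColouring c = record
    { colour = λ u → colour c (inj₁ u)
    ; proper = λ {u} {v} u~v → proper c {inj₁ u} {inj₁ v} u~v
    }

  root≢copy : ∀ {k} (c : Colouring (corona G H) k) u x →
    colour c (inj₁ u) ≢ colour c (inj₂ (u , x))
  root≢copy c u x = proper c {inj₁ u} {inj₂ (u , x)} refl

  -- The colour of a root never occurs in its copy, so `punchOut` can delete it from the palette.
  -- `coronaColouring` reverses this with `punchIn`.
  copyColouring : ∀ {k} → Colouring (corona G H) (suc k) → V G → Colouring H k
  copyColouring c u = record
    { colour = λ x → punchOut (root≢copy c u x)
    ; proper = λ {x} {y} x~y eq →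
        proper c {inj₂ (u , x)} {inj₂ (u , y)} (refl , x~y)
          (punchOut-injective (root≢copy c u x) (root≢copy c u y) eq)
    }

  coronaColouring : ∀ {k} → Colouring G (suc k) → Colouring H k → Colouring (corona G H) (suc k)
  coronaColouring {k} c d = record { colour = col ; proper = λ {a} {b} → prop a b }
    where
    col : V (corona G H) → Fin (suc k)
    col (inj₁ u)       = colour c u
    col (inj₂ (u , x)) = punchIn (colour c u) (colour d x)
    prop : ∀ a b → CoronaAdj G H a b → col a ≢ col b
    prop (inj₁ _)       (inj₁ _)        u~v          = proper c u~v
    prop (inj₁ u)       (inj₂ (.u , y)) refl         = punchInᵢ≢i (colour c u) (colour d y) ∘ sym
    prop (inj₂ (u , x)) (inj₁ .u)       refl         = punchInᵢ≢i (colour c u) (colour d x)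
    prop (inj₂ (u , x)) (inj₂ (.u , y)) (refl , x~y) =
      proper d x~y ∘ punchIn-injective (colour c u) (colour d x) (colour d y)

  -- This is the local identity `at` summed over all roots, arranged so that neither subtraction nor
  -- division occurs.
  corona-classSize : Cubic H → (c : Colouring (corona G H) 3) → ∀ j →
    2 * classSize c j + order H * classSize (baseColouring c) j
      ≡ order G * order H + 2 * classSize (baseColouring c) j
  corona-classSize cubic c j = begin
    2 * classSize c j + m * classSize (baseColouring c) j
      ≡⟨ cong₂ (λ t s → 2 * t + m * s)
           (trans (classSize≡∑ (corona G H) c j) (∑-corona _)) base≡ ⟩
    2 * ∑ G (λ u → e u + copy u) + m * ∑ G e
      ≡⟨ cong₂ _+_ (*-∑ G 2 _) (*-∑ G m _) ⟩
    ∑ G (λ u → 2 * (e u + copy u)) + ∑ G (λ u → m * e u)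
      ≡⟨ ∑-+ G _ _ ⟨
    ∑ G (λ u → 2 * (e u + copy u) + m * e u)
      ≡⟨ ∑-cong G at ⟩
    ∑ G (λ u → m + 2 * e u)
      ≡⟨ ∑-+ G _ _ ⟩
    ∑ G (λ _ → m) + ∑ G (λ u → 2 * e u)
      ≡⟨ cong₂ _+_ (∑-const G m) (sym (*-∑ G 2 _)) ⟩
    order G * m + 2 * ∑ G e
      ≡⟨ cong (λ s → order G * m + 2 * s) base≡ ⟨
    order G * m + 2 * classSize (baseColouring c) j ∎
    where
    open ≡-Reasoning
    m = order H
    e copy : V G → ℕ
    e u    = 𝟙 (colour c (inj₁ u) ≟ j)
    copy u = ∑ H (λ x → 𝟙 (colour c (inj₂ (u , x)) ≟ j))

    base≡ : classSize (baseColouring c) j ≡ ∑ G e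
    base≡ = classSize≡∑ G (baseColouring c) j

    avoided : ∀ u → colour c (inj₁ u) ≡ j → copy u ≡ 0
    avoided u u≡j = trans (∑-cong H none) (trans (∑-const H 0) (*-zeroʳ m))
      where
      none : ∀ x → 𝟙 (colour c (inj₂ (u , x)) ≟ j) ≡ 0
      none x with colour c (inj₂ (u , x)) ≟ j
      ... | yes x≡j = contradiction (trans u≡j (sym x≡j)) (root≢copy c u x)
      ... | no _    = refl

    -- After the root's colour is deleted, colour `j` survives under the name `punchOut u≢j`, and
    -- its class is half of the copy.
    half : ∀ u → colour c (inj₁ u) ≢ j → 2 * copy u ≡ m
    half u u≢j = trans (cong (2 *_) (∑-cong H same))
                       (2-class-half H cubic (copyColouring c u) (punchOut u≢j))
      where
      same : ∀ x → 𝟙 (colour c (inj₂ (u , x)) ≟ j)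
                 ≡ 𝟙 (colour (copyColouring c u) x ≟ punchOut u≢j)
      same x with colour c (inj₂ (u , x)) ≟ j
                | colour (copyColouring c u) x ≟ punchOut u≢j
      ... | yes _   | yes _  = refl
      ... | no _    | no _   = refl
      ... | yes x≡j | no x≢j = contradiction (punchOut-cong (colour c (inj₁ u)) x≡j) x≢j
      ... | no x≢j  | yes x≡j = contradiction (punchOut-injective (root≢copy c u x) u≢j x≡j) x≢j

    at : ∀ u → 2 * (e u + copy u) + m * e u ≡ m + 2 * e u
    at u with colour c (inj₁ u) ≟ j
    -- For a root of colour `j` both sides are m + 2; for any other root both are m.
    ... | yes u≡j rewrite avoided u u≡j = trans (cong (2 +_) (*-identityʳ m)) (+-comm 2 m)
    ... | no u≢j  = cong₂ _+_ (half u u≢j) (*-zeroʳ m)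

-- Arithmetic of the class-size identity.

module _ (m K : ℕ) (t s : A → ℕ) (size : ∀ a → 2 * t a + m * s a ≡ K + 2 * s a) where

  equal-base⇒equal-corona : ∀ {a b} → s a ≡ s b → t a ≡ t b
  equal-base⇒equal-corona {a} {b} sa≡sb = *-cancelˡ-≡ _ _ 2 (+-cancelʳ-≡ (m * s b) _ _ (begin
    2 * t a + m * s b  ≡⟨ cong (λ x → 2 * t a + m * x) sa≡sb ⟨
    2 * t a + m * s a  ≡⟨ size a ⟩
    K + 2 * s a        ≡⟨ cong (λ x → K + 2 * x) sa≡sb ⟩
    K + 2 * s b        ≡⟨ size b ⟨
    2 * t b + m * s b  ∎))
    where open ≡-Reasoning

  -- Cancelling `2 * s x` leaves 2 t + (m - 2) s = K with m - 2 at least 4. Raising s by one or more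
  -- therefore lowers 2 t by at least 4, hence t by at least 2.
  close-corona⇒base≮ : 6 ≤ m → ∀ {a b} → ∣ t a - t b ∣ ≤ 1 → ¬ s a < s b
  close-corona⇒base≮ 6≤m {a} {b} close sa<sb
    -- Here r = m - 6 and δ = s b - s a - 1, which keeps the later identities free of subtraction.
    with r , 6+r≡m ← m≤n⇒∃[o]m+o≡n 6≤m
       | δ , 1+sa+δ≡sb ← m≤n⇒∃[o]m+o≡n sa<sb
    = <-irrefl refl (begin-strict
      t b + 1             <⟨ ≤-reflexive (sym (+-suc (t b) 1)) ⟩
      t b + 2             ≤⟨ *-cancelˡ-≤ 2 double ⟩
      t a                 ≤⟨ m≤n+∣m-n∣ (t a) (t b) ⟩
      t b + ∣ t a - t b ∣ ≤⟨ +-monoʳ-≤ (t b) close ⟩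
      t b + 1             ∎)
    where
    open ≤-Reasoning
    reduce : ∀ x → 2 * t x + (4 + r) * s x ≡ K
    reduce x = +-cancelʳ-≡ (2 * s x) _ _ (trans (shift r (t x) (s x))
      (trans (cong (λ n → 2 * t x + n * s x) 6+r≡m) (size x)))
      where
      shift : ∀ r t s → 2 * t + (4 + r) * s + 2 * s ≡ 2 * t + (6 + r) * s
      shift = solve-∀
    expand : ∀ r s δ t → 2 * t + (4 + r) * (suc s + δ)
                       ≡ 2 * (t + 2) + (r + (4 + r) * δ) + (4 + r) * s
    expand = solve-∀
    -- The last summand is the excess over the guaranteed gap of 4; only its being nonnegative
    -- matters.
    exact : 2 * t a ≡ 2 * (t b + 2) + (r + (4 + r) * δ)
    exact = +-cancelʳ-≡ ((4 + r) * s a) _ _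
      (trans (reduce a) (trans (sym (reduce b))
        (trans (cong (λ x → 2 * t b + (4 + r) * x) (sym 1+sa+δ≡sb)) (expand r (s a) δ (t b)))))
    double : 2 * (t b + 2) ≤ 2 * t a
    double = ≤-trans (m≤m+n _ _) (≤-reflexive (sym exact))

-- Passing between a graph and its corona.

module _ (H : Graph) (cubic : Cubic H) where

  -- Every copy receives the same colouring of `H`, renamed to avoid its root. No new count is
  -- needed, since `corona-classSize` holds for every 3-colouring of the corona.
  corona-strong : ∀ {G} → Colouring H 2 →
    StronglyEquitablyColourable G 3 → StronglyEquitablyColourable (corona G H) 3
  corona-strong {G} d (c , equal) = c⁺ , λ i j →
    equal-base⇒equal-corona (order H) (order G * order H) (classSize c⁺) (classSize c)
      (corona-classSize G H cubic c⁺) (equal i j)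
    where c⁺ = coronaColouring G H c d

  corona-equitable⇒base-strong : ∀ {G} → V G → V H →
    EquitablyColourable (corona G H) 3 → StronglyEquitablyColourable G 3
  corona-equitable⇒base-strong {G} u x (c , close) = baseColouring G H c , equal
    where
    b = baseColouring G H c
    base≮ : ∀ {i j} → ∣ classSize c i - classSize c j ∣ ≤ 1 → ¬ classSize b i < classSize b j
    base≮ = close-corona⇒base≮ (order H) (order G * order H) (classSize c) (classSize b)
      -- The copy attached to `u` supplies the 2-colouring of `H` that gives 6 ≤ m.
      (corona-classSize G H cubic c) (6≤order H cubic (copyColouring G H c u) x)
    equal : ∀ i j → classSize b i ≡ classSize b j
    equal i j with <-cmp (classSize b i) (classSize b j)
    ... | tri< i<j _ _ = contradiction i<j (base≮ (close i j))
    ... | tri≈ _ i≡j _ = i≡j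
    ... | tri> _ _ j<i = contradiction j<i (base≮ (close j i))

  -- An edge of `H` uses two colours inside a copy, and the root needs a third.
  corona-colours≥3 : ∀ {G k} → V G → V H → Colourable (corona G H) k → 3 ≤ k
  corona-colours≥3 {k = zero}  u x c with () ← colour c (inj₁ u)
  corona-colours≥3 {G} {suc k} u x c =
    s≤s (edge⇒2≤k H (proj₂ (degree-positive⇒neighbour H x (cubic x))) (copyColouring G H c u))

-- Iterated coronas.

strong⇒equitable : ∀ {G k} → StronglyEquitablyColourable G k → EquitablyColourable G k
strong⇒equitable (c , equal) = c , λ i j → ≤-trans (≤-reflexive (m≡n⇒∣m-n∣≡0 (equal i j))) z≤n

coronaPower-root : ∀ {G H} l → V G → V (coronaPower G l H)
coronaPower-root zero    u = u
coronaPower-root (suc l) u = inj₁ (coronaPower-root l u)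

theorem3p2 : (G H : Graph) → Connected G → Cubic G → Connected H → Cubic H →
    (l : ℕ) → 1 ≤ l →
    (χ₌ coronaPower G l H ≡ 3) ⇔ (StronglyEquitablyColourable G 3 × Q₂ H)
theorem3p2 G H (u , _) _ connH@(x , _) cubicH (suc l) _ = mk⇔ forward backward
  where
  G^_ = λ l → coronaPower G l H

  root : ∀ l → V (G^ l)
  root l = coronaPower-root l u

  descend : ∀ l → EquitablyColourable (G^ suc l) 3 → StronglyEquitablyColourable G 3
  descend zero    e = corona-equitable⇒base-strong H cubicH u x e
  -- Removing a layer improves equitable to strong; weakening the result again lets the next layer
  -- be removed.
  descend (suc l) e = descend l
    (strong⇒equitable (corona-equitable⇒base-strong H cubicH (root (suc l)) x e))

  ascend : Colouring H 2 → StronglyEquitablyColourable G 3 →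
    ∀ l → StronglyEquitablyColourable (G^ l) 3
  ascend d s zero    = s
  ascend d s (suc l) = corona-strong H cubicH d (ascend d s l)

  forward : χ₌ G^ suc l ≡ 3 → StronglyEquitablyColourable G 3 × Q₂ H
  -- The 2-colouring of `H` is read off one copy in the outermost layer; an edge at `x` rules out
  -- fewer colours.
  forward (e@(c , _) , _) = descend l e , connH , cubicH ,
    copyColouring (G^ l) H c (root l) ,
    λ _ → edge⇒2≤k H (proj₂ (degree-positive⇒neighbour H x (cubicH x)))

  backward : StronglyEquitablyColourable G 3 × Q₂ H → χ₌ G^ suc l ≡ 3
  backward (s , _ , _ , d , _) =
    strong⇒equitable (ascend d s (suc l)) ,
    -- The lower bound holds for all proper colourings, so the equitability condition is dropped by
    -- `proj₁`.
    λ _ → corona-colours≥3 H cubicH (root l) x ∘ proj₁
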